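{- Let $K$ be a field of characteristic zero and let $q\in K$ be nonzero and not a root of unity (for instance, $q$ an indeterminate and $K=\mathbb{Q}(q)$). For all integers $n\ge 1$ and $m\ge 1$, $$ \sum_{1\le k\le n}\genfrac{[}{]}{0pt}{}{n}{k}_q(-1)^{k-1}q^{ -kn+\binom k2}\sum_{1\le i_1\le i_2\le\dots\le i_m=k}\frac{q^{i_1}}{1-q^{i_1}}\cdots\frac{q^{i_m}}{1-q^{i_m}}=\sum_{1\le k\le n}\frac{q^{k(m-1)}}{(1-q^k)^m}. $$ Here, for each $k$, the inner sum runs over all $m$-tuples of integers $(i_1,\dots,i_m)$ with $1\le i_1\le i_2\le\dots\le i_m$ and $i_m=k$.
   Context: For $0\le k\le n$, $\genfrac{[}{]}{0pt}{}{n}{k}_q$ denotes the Gaussian polynomial ($q$-binomial coefficient) $$\genfrac{[}{]}{0pt}{}{n}{k}_q=\frac{(q;q)_n}{(q;q)_k(q;q)_{n-k}},\qquad (x;q)_n:=(1-x)(1-xq)\cdots(1-xq^{n-1}),\quad (x;q)_0=1.$$ $\binom k2=k(k-1)/2$ is the ordinary binomial coefficient. -}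

module Defs where

open import Algebra using (CommutativeRing; Semiring)
open import Algebra.Apartness using (HeytingCommutativeRing; HeytingField)
import Algebra.Apartness.Properties.HeytingCommutativeRing as HeytingProperties
import Algebra.Definitions.RawSemiring as RawSemiringDefinitions
open import Data.Fin.Base as Fin using (Fin; toℕ)
import Data.Fin.Properties as Fin
open import Data.Integer.Base as ℤ using (ℤ; +_; -[1+_])
open import Data.List.Base as List using (List; allFin; cartesianProductWith; filter)
open import Data.Nat.Base as ℕ using (ℕ; zero; suc; NonZero; _∸_)
import Data.Nat.Properties as ℕ
open import Data.Product.Base using (_×_; _,_; proj₁; proj₂)
open import Data.Vec.Base as Vec using (Vec; []; _∷_; last)
open import Data.Vec.Relation.Unary.Linked using (Linked; linked?)
open import Relation.Binary.PropositionalEquality.Core using (_≡_)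
open import Relation.Nullary.Decidable using (Dec; _×-dec_)
open import Relation.Nullary.Negation using (¬_)

-- In a tuple with entries in Fin k, the entry i stands for the integer
-- index i ∈ {1, …, k}.

index : ∀ {k} → Fin k → ℕ
index i = suc (toℕ i)

-- i₁ ≤ i₂ ≤ … ≤ iₘ = k

IsChain : ∀ {k m} → .{{NonZero m}} → Vec (Fin k) m → Set
IsChain {k} {suc _} i = Linked Fin._≤_ i × index (last i) ≡ k

isChain? : ∀ {k m} → .{{_ : NonZero m}} → (i : Vec (Fin k) m) → Dec (IsChain i)
isChain? {k} {suc _} i = linked? Fin._≤?_ i ×-dec (index (last i) ℕ.≟ k)

allTuples : ∀ k m → List (Vec (Fin k) m)
allTuples k zero    = List.[ [] ]
allTuples k (suc m) = cartesianProductWith _∷_ (allFin k) (allTuples k m)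

-- The m-tuples of integers with 1 ≤ i₁ ≤ … ≤ iₘ = k. Bounding all entries
-- by k in advance loses nothing, because the last entry is the largest.

chains : ∀ m → .{{NonZero m}} → (k : ℕ) → List (Vec (Fin k) m)
chains m k = filter isChain? (allTuples k m)

module FieldNotions {c ℓ₁ ℓ₂} (K : HeytingField c ℓ₁ ℓ₂) where

  open HeytingField K
  open HeytingProperties heytingCommutativeRing
    using (x-0≈x; 1#0; x#0y#0→xy#0; invertibleˡ⇒#)
  open HeytingCommutativeRing heytingCommutativeRing using (commutativeRing)
  open CommutativeRing commutativeRing using (semiring)
  open RawSemiringDefinitions (Semiring.rawSemiring semiring) public
    using (_^_; sum; product)
  open RawSemiringDefinitions (Semiring.rawSemiring semiring)
    using () renaming (_×_ to _·_)

  -- Inequations on elements to be inverted are read as apartness _#_; here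
  -- nothing is inverted, and plain inequality is the weaker assumption.

  CharacteristicZero : Set ℓ₁
  CharacteristicZero = ∀ n → .{{NonZero n}} → ¬ (n · 1# ≈ 0#)

  NotRootOfUnity : Carrier → Set ℓ₂
  NotRootOfUnity q = ∀ n → .{{NonZero n}} → q ^ n # 1#

  inv : ∀ x → x # 0# → Carrier
  inv x x#0 = proj₁ (#⇒invertible x#0)

  -- #⇒invertible literally provides an inverse of x - 0#.

  inv-inverseˡ : ∀ x (x#0 : x # 0#) → inv x x#0 * x ≈ 1#
  inv-inverseˡ x x#0 =
    trans (*-congˡ (sym (x-0≈x x))) (proj₁ (proj₂ (#⇒invertible x#0)))

  infixl 7 _/_[_]

  _/_[_] : Carrier → ∀ y → y # 0# → Carrier
  x / y [ y#0 ] = x * inv y y#0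

  zpow : ∀ x → x # 0# → ℤ → Carrier
  zpow x x#0 (+ n)    = x ^ n
  zpow x x#0 -[1+ n ] = inv x x#0 ^ suc n

  ∑-range : ∀ n → ((k : ℕ) → .{{NonZero k}} → Carrier) → Carrier
  ∑-range n f = sum {n} λ i → f (index i)

  ∑-list : ∀ {a} {A : Set a} → List A → (A → Carrier) → Carrier
  ∑-list xs f = List.foldr _+_ 0# (List.map f xs)

  syntax ∑-range n (λ k → e) = ∑[1≤ k ≤ n ] e
  syntax ∑-list xs (λ x → e) = ∑[ x ∈ xs ] e

  ∏-entries : ∀ {a} {A : Set a} {m} → Vec A m → (A → Carrier) → Carrier
  ∏-entries xs f = product λ j → f (Vec.lookup xs j)

  syntax ∏-entries xs (λ x → e) = ∏[ x ∈ xs ] e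

  -- (x;q)ₙ = (1 - x)(1 - xq)⋯(1 - xqⁿ⁻¹)

  pochhammer : Carrier → Carrier → ℕ → Carrier
  pochhammer x q n = product {n} λ i → 1# - x * q ^ toℕ i

  x#y⇒x-y#0 : ∀ {x y} → x # y → x - y # 0#
  x#y⇒x-y#0 {x} {y} x#y with #⇒invertible x#y
  ... | z , z[x-y]≈1 , _ = invertibleˡ⇒# (z , trans (*-congˡ (x-0≈x (x - y))) z[x-y]≈1)

  ^#0 : ∀ {x} → x # 0# → ∀ n → x ^ n # 0#
  ^#0 x#0 zero    = 1#0
  ^#0 x#0 (suc n) = x#0y#0→xy#0 x#0 (^#0 x#0 n)

  product#0 : ∀ {n} (f : Fin n → Carrier) → (∀ i → f i # 0#) → product f # 0#
  product#0 {zero}  f f#0 = 1#0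
  product#0 {suc n} f f#0 =
    x#0y#0→xy#0 (f#0 Fin.zero) (product#0 (λ i → f (Fin.suc i)) (λ i → f#0 (Fin.suc i)))

  module _ {q : Carrier} (q^n#1 : NotRootOfUnity q) where

    1-q^#0 : ∀ k → .{{NonZero k}} → 1# - q ^ k # 0#
    1-q^#0 k = x#y⇒x-y#0 (#-sym (q^n#1 k))

    pochhammer#0 : ∀ n → pochhammer q q n # 0#
    pochhammer#0 n = product#0 {n} _ λ i → 1-q^#0 (index i)

    -- Only meaningful for k ≤ n, because of the truncated subtraction.

    qBinomial : ℕ → ℕ → Carrier
    qBinomial n k =
      pochhammer q q n / (pochhammer q q k * pochhammer q q (n ∸ k))
        [ x#0y#0→xy#0 (pochhammer#0 k) (pochhammer#0 (n ∸ k)) ]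

-- Write xₖ = qᵏ/(1 − qᵏ) and c(n, k) = (−1)ᵏ⁻¹ q^(−kn + C(k,2)) [n, k]. By
-- Pascal's rule d(n, k) = c(n, k) − c(n − 1, k) equals
-- (−1)ᵏ⁻¹ q^(−kn + C(k,2)) [n − 1, k − 1], and it satisfies
-- xₖ d(n, k) = xₙ (d(n, k) − d(n, k + 1)). By induction on m, telescoping the sum
-- over i₁, the sum of x_{i₁} ⋯ x_{iₘ} d(n, iₘ) over i ≤ i₁ ≤ ⋯ ≤ iₘ equals
-- xₙᵐ d(n, i). For i = 1 this is xₙᵐ q⁻ⁿ, the n-th summand of the right-hand side.

module Submission where

open import Defs
open import Algebra using (CommutativeRing)
open import Algebra.Apartness using (HeytingField; HeytingCommutativeRing)
import Algebra.Properties.CommutativeSemiring.Exp as Exp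
import Algebra.Properties.Monoid.Sum as MonoidSum
import Algebra.Properties.Ring as RingProperties
import Algebra.Properties.Semiring.Sum as SemiringSum
import Algebra.Solver.Ring.NaturalCoefficients.Default as Solver
open import Data.Bool.Base using (Bool; true; false; _∧_)
open import Data.Bool.Properties using (∧-assoc)
open import Data.Fin.Base as Fin using (Fin; toℕ)
import Data.Fin.Properties as Fin
open import Data.Integer.Base as ℤ using (+_)
import Data.Integer.Properties as ℤ
open import Data.List.Base as List using (List; []; _∷_; _++_; filter; cartesianProductWith)
open import Data.Nat.Base as ℕ using (ℕ; zero; suc; NonZero; _∸_; _≤ᵇ_; s≤s; z≤n)
open import Data.Nat.Combinatorics using (_C_; nC1≡n; nCk+nC[k+1]≡[n+1]C[k+1])
import Data.Nat.Properties as ℕ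
open import Data.Vec.Base as Vec using (Vec; []; _∷_)
open import Function.Base using (_∘_; id)
open import Relation.Binary.PropositionalEquality as ≡ using (_≡_)
import Relation.Binary.Reasoning.Setoid as ≈-Reasoning
open import Relation.Nullary.Decidable using (Dec; does; dec-true; dec-false)

module FieldProperties {c ℓ₁ ℓ₂} (K : HeytingField c ℓ₁ ℓ₂) where

  open HeytingField K hiding (zero)
  open FieldNotions K
  open HeytingCommutativeRing heytingCommutativeRing using (commutativeRing)
  open CommutativeRing commutativeRing
    using (semiring; commutativeSemiring; ring; *-monoid)
  open RingProperties ring using (+-cancelʳ)
  open Exp commutativeSemiring using (^-homo-*; ^-assocʳ; ^-congˡ; ^-distrib-*)
  open SemiringSum semiring
    using (sum-cong-≋; sum-replicate-zero; sum-init-last; ∑-distrib-+; *-distribˡ-sum)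
  open Solver commutativeSemiring
  open ≈-Reasoning setoid

  -- Inverses and integer powers.

  1^n≈1 : ∀ n → 1# ^ n ≈ 1#
  1^n≈1 zero    = refl
  1^n≈1 (suc n) = trans (*-identityˡ _) (1^n≈1 n)

  /-unique : ∀ {x y z} (z#0 : z # 0#) → y * z ≈ x → x / z [ z#0 ] ≈ y
  /-unique {x} {y} {z} z#0 yz≈x = begin
    x * inv z z#0        ≈⟨ *-congʳ yz≈x ⟨
    y * z * inv z z#0    ≈⟨ solve 3 (λ y z i → y :* z :* i := y :* (i :* z)) refl y z _ ⟩
    y * (inv z z#0 * z)  ≈⟨ *-congˡ (inv-inverseˡ z z#0) ⟩
    y * 1#               ≈⟨ *-identityʳ y ⟩
    y                    ∎

  zpow-⊖ : ∀ x (x#0 : x # 0#) a b → zpow x x#0 (b ℤ.⊖ a) ≈ inv x x#0 ^ a * x ^ b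
  zpow-⊖ x x#0 zero    b       = sym (*-identityˡ _)
  zpow-⊖ x x#0 (suc a) zero    = sym (*-identityʳ _)
  zpow-⊖ x x#0 (suc a) (suc b) = begin
    zpow x x#0 (suc b ℤ.⊖ suc a)  ≡⟨ ≡.cong (zpow x x#0) (ℤ.[1+m]⊖[1+n]≡m⊖n b a) ⟩
    zpow x x#0 (b ℤ.⊖ a)          ≈⟨ zpow-⊖ x x#0 a b ⟩
    -- The 1 is expanded as `p * x`, one factor for each of the two powers.
    p ^ a * x ^ b                 ≈⟨ *-identityˡ _ ⟨
    1# * (p ^ a * x ^ b)          ≈⟨ *-congʳ (inv-inverseˡ x x#0) ⟨
    p * x * (p ^ a * x ^ b)
      ≈⟨ solve 4 (λ p x y z → p :* x :* (y :* z) := p :* y :* (x :* z)) refl p x _ _ ⟩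
    p ^ suc a * x ^ suc b         ∎
    where p = inv x x#0

  -- Negation of `+ a` computes only once `a` is a constructor; in both cases the exponent then
  -- agrees by computation with `b ⊖ a`.
  zpow-neg-+ : ∀ x (x#0 : x # 0#) a b →
               zpow x x#0 (ℤ.- (+ a) ℤ.+ + b) ≈ inv x x#0 ^ a * x ^ b
  zpow-neg-+ x x#0 zero    b = zpow-⊖ x x#0 zero b
  zpow-neg-+ x x#0 (suc a) b = zpow-⊖ x x#0 (suc a) b

  -- Sums over tuples

  -- An Iverson bracket: filtering becomes multiplication by 0 or 1, so that a conjunction of
  -- conditions can be taken apart factor by factor.
  𝟙 : Bool → Carrier
  𝟙 true  = 1#
  𝟙 false = 0#

  𝟙-∧ : ∀ a b → 𝟙 (a ∧ b) ≈ 𝟙 a * 𝟙 b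
  𝟙-∧ true  b = sym (*-identityˡ _)
  𝟙-∧ false b = sym (zeroˡ _)

  module _ {a} {A : Set a} where

    ∑-list-cong : ∀ (xs : List A) {f g : A → Carrier} → (∀ x → f x ≈ g x) →
                  ∑-list xs f ≈ ∑-list xs g
    ∑-list-cong []       f≈g = refl
    ∑-list-cong (x ∷ xs) f≈g = +-cong (f≈g x) (∑-list-cong xs f≈g)

    *-distribˡ-∑-list : ∀ x (ys : List A) f → x * ∑-list ys f ≈ ∑-list ys (λ y → x * f y)
    *-distribˡ-∑-list x []       f = zeroʳ x
    *-distribˡ-∑-list x (y ∷ ys) f = trans (distribˡ _ _ _) (+-congˡ (*-distribˡ-∑-list x ys f))

    ∑-list-++ : ∀ (xs ys : List A) f → ∑-list (xs ++ ys) f ≈ ∑-list xs f + ∑-list ys f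
    ∑-list-++ []       ys f = sym (+-identityˡ _)
    ∑-list-++ (x ∷ xs) ys f = trans (+-congˡ (∑-list-++ xs ys f)) (sym (+-assoc _ _ _))

    ∑-list-map : ∀ {b} {B : Set b} (h : B → A) ys f →
                 ∑-list (List.map h ys) f ≈ ∑-list ys (f ∘ h)
    ∑-list-map h []       f = refl
    ∑-list-map h (y ∷ ys) f = +-congˡ (∑-list-map h ys f)

    ∑-list-tabulate : ∀ {n} (h : Fin n → A) f → ∑-list (List.tabulate h) f ≈ sum (f ∘ h)
    ∑-list-tabulate {zero}  h f = refl
    ∑-list-tabulate {suc n} h f = +-congˡ (∑-list-tabulate (h ∘ Fin.suc) f)

    ∑-list-filter : ∀ {p} {P : A → Set p} (P? : ∀ x → Dec (P x)) xs f →
                    ∑-list (filter P? xs) f ≈ ∑-list xs (λ x → 𝟙 (does (P? x)) * f x)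
    ∑-list-filter P? []       f = refl
    ∑-list-filter P? (x ∷ xs) f with does (P? x)
    ... | true  = +-cong (sym (*-identityˡ _)) (∑-list-filter P? xs f)
    ... | false = trans (∑-list-filter P? xs f)
                        (sym (trans (+-congʳ (zeroˡ _)) (+-identityˡ _)))

  ∑-list-cartesianProductWith :
    ∀ {a b d} {A : Set a} {B : Set b} {D : Set d} (h : A → B → D) xs ys f →
    ∑-list (cartesianProductWith h xs ys) f ≈ ∑-list xs (λ x → ∑-list ys (λ y → f (h x y)))
  ∑-list-cartesianProductWith h []       ys f = refl
  ∑-list-cartesianProductWith h (x ∷ xs) ys f =
    trans (∑-list-++ (List.map (h x) ys) _ f)
          (+-cong (∑-list-map (h x) ys f) (∑-list-cartesianProductWith h xs ys f))

  ∑-allTuples-suc : ∀ k m f →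
    ∑-list (allTuples k (suc m)) f ≈ sum {k} λ j → ∑-list (allTuples k m) (λ v → f (j ∷ v))
  ∑-allTuples-suc k m f =
    trans (∑-list-cartesianProductWith _∷_ (List.allFin k) (allTuples k m) f)
          (∑-list-tabulate {n = k} id _)

  -- Sums over initial and final segments of indices.

  sum-zero : ∀ {n} {f : Fin n → Carrier} → (∀ i → f i ≈ 0#) → sum f ≈ 0#
  sum-zero {n} f≈0 = trans (sum-cong-≋ f≈0) (sum-replicate-zero n)

  sum-last : ∀ n (f : ℕ → Carrier) →
             sum {suc n} (f ∘ toℕ) ≈ sum {n} (f ∘ toℕ) + f n
  sum-last n f = trans (sum-init-last {n} (f ∘ toℕ))
    (+-cong (sum-cong-≋ {n} λ i → reflexive (≡.cong f (Fin.toℕ-inject₁ i)))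
            (reflexive (≡.cong f (Fin.toℕ-fromℕ n))))

  suc-≤ᵇ-suc : ∀ i j → (suc i ≤ᵇ suc j) ≡ (i ≤ᵇ j)
  suc-≤ᵇ-suc zero    j = ≡.refl
  suc-≤ᵇ-suc (suc i) j = ≡.refl

  -- The lower bound is a 0/1 factor, so the range stays `Fin k`, the type of the tuple entries,
  -- while the bound moves.
  sumFrom : ℕ → (k : ℕ) → (ℕ → Carrier) → Carrier
  sumFrom i k f = sum {k} λ j → 𝟙 (i ≤ᵇ toℕ j) * f (toℕ j)

  sumFrom-suc : ∀ i k f → sumFrom (suc i) (suc k) f ≈ sumFrom i k (f ∘ suc)
  sumFrom-suc i k f = trans (+-congʳ (zeroˡ _)) (trans (+-identityˡ _)
    (sum-cong-≋ {k} λ j → *-congʳ (reflexive (≡.cong 𝟙 (suc-≤ᵇ-suc i (toℕ j))))))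

  sumFrom-empty : ∀ {i k} f → k ℕ.≤ i → sumFrom i k f ≈ 0#
  sumFrom-empty             f z≤n       = refl
  sumFrom-empty {suc i} {suc k} f (s≤s k≤i) =
    trans (sumFrom-suc i k f) (sumFrom-empty (f ∘ suc) k≤i)

  sumFrom-head : ∀ {i k} f → i ℕ.< k → sumFrom i k f ≈ f i + sumFrom (suc i) k f
  sumFrom-head {zero}  {suc k} f (s≤s z≤n) =
    +-cong (*-identityˡ _) (sym (sumFrom-suc 0 k f))
  sumFrom-head {suc i} {suc k} f (s≤s i<k) = begin
    sumFrom (suc i) (suc k) f               ≈⟨ sumFrom-suc i k f ⟩
    sumFrom i k (f ∘ suc)                   ≈⟨ sumFrom-head (f ∘ suc) i<k ⟩
    f (suc i) + sumFrom (suc i) k (f ∘ suc) ≈⟨ +-congˡ (sumFrom-suc (suc i) k f) ⟨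
    f (suc i) + sumFrom (suc (suc i)) (suc k) f ∎

  -- Sums over chains and summation by parts.

  module Chains (X : ℕ → Carrier) where

    -- The sum of X j₁ ⋯ X jₘ over i ≤ j₁ ≤ ⋯ ≤ jₘ = i + r, split according
    -- to whether j₁ = i; for m = 0 the condition jₘ = i + r reads i = i + r.

    chainSum : (m r i : ℕ) → Carrier
    chainSum zero    zero    i = 1#
    chainSum zero    (suc r) i = 0#
    chainSum (suc m) zero    i = X i * chainSum m zero i
    chainSum (suc m) (suc r) i = X i * chainSum m (suc r) i + chainSum (suc m) r (suc i)

    -- The product over the entries, times the indicator of a weakly increasing tuple that starts at
    -- `i` or above and ends at k - 1. In the recursion `i` is the latest entry passed, so the empty
    -- tuple tests whether that entry is k - 1.
    weight : ∀ {k m} → ℕ → Vec (Fin k) m → Carrier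
    weight {k} i []      = 𝟙 (does (suc i ℕ.≟ k))
    weight     i (j ∷ v) = 𝟙 (i ≤ᵇ toℕ j) * (X (toℕ j) * weight (toℕ j) v)

    -- Induction on the tail: `j ∷ j′ ∷ v` and `j′ ∷ v` have the same last entry, so their chain
    -- conditions differ only by the comparison of `j` with `j′`.
    isChain-weight : ∀ {k m} (j : Fin k) (v : Vec (Fin k) m) →
      𝟙 (does (isChain? (j ∷ v))) * (∏[ i ∈ j ∷ v ] X (toℕ i)) ≈ X (toℕ j) * weight (toℕ j) v
    isChain-weight {k} j [] =
      solve 2 (λ b x → b :* (x :* con 1) := x :* b) refl
        (𝟙 (does (index j ℕ.≟ k))) (X (toℕ j))
    isChain-weight {k} j (j′ ∷ v) = begin
      𝟙 (does (isChain? (j ∷ j′ ∷ v))) * (x * y)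
        -- The decision is bracketed as (comparison ∧ tail linked) ∧ last entry; reassociating
        -- exposes `isChain?` of the tail.
        ≈⟨ *-congʳ (trans (reflexive (≡.cong 𝟙 (∧-assoc (toℕ j ≤ᵇ toℕ j′) _ _)))
                          (𝟙-∧ (toℕ j ≤ᵇ toℕ j′) _)) ⟩
      𝟙 (toℕ j ≤ᵇ toℕ j′) * 𝟙 (does (isChain? (j′ ∷ v))) * (x * y)
        ≈⟨ solve 4 (λ a b x y → a :* b :* (x :* y) := x :* (a :* (b :* y))) refl _ _ x y ⟩
      x * (𝟙 (toℕ j ≤ᵇ toℕ j′) * (𝟙 (does (isChain? (j′ ∷ v))) * y))
        ≈⟨ *-congˡ (*-congˡ (isChain-weight j′ v)) ⟩
      x * weight (toℕ j) (j′ ∷ v) ∎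
      where
      x = X (toℕ j)
      y = ∏[ i ∈ j′ ∷ v ] X (toℕ i)

    ∑-weight-suc : ∀ k m i →
      ∑-list (allTuples k (suc m)) (weight i)
      ≈ sumFrom i k (λ j → X j * ∑-list (allTuples k m) (weight j))
    ∑-weight-suc k m i = trans (∑-allTuples-suc k m (weight i)) (sum-cong-≋ {k} λ j → sym
      (trans (*-congˡ (*-distribˡ-∑-list (X (toℕ j)) (allTuples k m) (weight (toℕ j))))
             (*-distribˡ-∑-list (𝟙 (i ≤ᵇ toℕ j)) (allTuples k m) _)))

    -- The equation makes i + r = k - 1 the largest entry in `Fin k`, the value that `chainSum`
    -- prescribes for the last index. The induction separates a first entry equal to i from one that
    -- is at least i + 1.
    ∑-weight : ∀ {k} m r i → i ℕ.+ suc r ≡ k →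
               ∑-list (allTuples k m) (weight i) ≈ chainSum m r i
    ∑-weight {k} zero zero i eq = trans (+-identityʳ _) (reflexive
      (≡.cong 𝟙 (dec-true (suc i ℕ.≟ k) (≡.trans (ℕ.+-comm 1 i) eq))))
    ∑-weight {k} zero (suc r) i eq = trans (+-identityʳ _) (reflexive
      (≡.cong 𝟙 (dec-false (suc i ℕ.≟ k) λ 1+i≡k →
        ℕ.m≢1+m+n (suc i) (≡.trans 1+i≡k (≡.trans (≡.sym eq)
          (≡.trans (ℕ.+-suc i (suc r)) (≡.cong suc (ℕ.+-suc i r))))))))
    ∑-weight {k} (suc m) r i eq = begin
      ∑-list (allTuples k (suc m)) (weight i)  ≈⟨ ∑-weight-suc k m i ⟩
      sumFrom i k F                            ≈⟨ sumFrom-head F i<k ⟩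
      F i + sumFrom (suc i) k F                ≈⟨ +-congʳ (*-congˡ (∑-weight m r i eq)) ⟩
      X i * chainSum m r i + sumFrom (suc i) k F  ≈⟨ rest r eq ⟩
      chainSum (suc m) r i                     ∎
      where
      F = λ j → X j * ∑-list (allTuples k m) (weight j)

      i<k : i ℕ.< k
      i<k = ≡.subst (i ℕ.<_) eq (ℕ.m<m+n i ℕ.z<s)

      rest : ∀ r → i ℕ.+ suc r ≡ k →
             X i * chainSum m r i + sumFrom (suc i) k F ≈ chainSum (suc m) r i
      -- For r = 0 no entry exceeds i and the remaining sum is empty; otherwise it is the same sum
      -- with bound i + 1 and r one smaller.
      rest zero    eq = trans
        (+-congˡ (sumFrom-empty F (ℕ.≤-reflexive (≡.trans (≡.sym eq) (ℕ.+-comm i 1)))))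
        (+-identityʳ _)
      rest (suc r) eq = +-congˡ (trans (sym (∑-weight-suc k m (suc i)))
        (∑-weight (suc m) r (suc i) (≡.trans (≡.sym (ℕ.+-suc i (suc r))) eq)))

    ∑-chains : ∀ m r →
      ∑-list (chains (suc m) (suc r)) (λ v → ∏[ i ∈ v ] X (toℕ i)) ≈ chainSum (suc m) r 0
    ∑-chains m r = begin
      ∑-list (chains (suc m) (suc r)) (λ v → ∏[ i ∈ v ] X (toℕ i))
        ≈⟨ ∑-list-filter isChain? tuples _ ⟩
      ∑-list tuples (λ v → 𝟙 (does (isChain? v)) * (∏[ i ∈ v ] X (toℕ i)))
        -- Every first entry meets the bound 0 of `weight`, which accounts for a factor 1.
        ≈⟨ ∑-list-cong tuples (λ { (j ∷ v) → trans (isChain-weight j v) (sym (*-identityˡ _)) }) ⟩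
      ∑-list tuples (weight 0)
        ≈⟨ ∑-weight (suc m) r 0 ≡.refl ⟩
      chainSum (suc m) r 0 ∎
      where tuples = allTuples (suc r) (suc m)

    -- Summation by parts in the smallest index: the hypothesis says that
    -- X j D j = z (D j − D (j + 1)).

    ∑-chainSum : ∀ {z} (D : ℕ → Carrier) →
      (∀ j → D j * X j + z * D (suc j) ≈ z * D j) →
      ∀ m L i → D (i ℕ.+ L) ≈ 0# →
      sum {L} (λ r → D (i ℕ.+ toℕ r) * chainSum m (toℕ r) i) ≈ z ^ m * D i
    -- For L = 0 the boundary hypothesis says that D i vanishes, matching the empty sum.
    ∑-chainSum {z} D step m zero i D≈0 = sym (begin
      z ^ m * D i            ≡⟨ ≡.cong (λ n → z ^ m * D n) (ℕ.+-identityʳ i) ⟨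
      z ^ m * D (i ℕ.+ 0)    ≈⟨ *-congˡ D≈0 ⟩
      z ^ m * 0#             ≈⟨ zeroʳ _ ⟩
      0#                     ∎)
    -- For m = 0 only the term r = 0 survives.
    ∑-chainSum {z} D step zero (suc L) i D≈0 = begin
      D (i ℕ.+ 0) * 1# + sum {L} (λ r → D (i ℕ.+ suc (toℕ r)) * 0#)
        ≈⟨ +-cong (*-congʳ (reflexive (≡.cong D (ℕ.+-identityʳ i)))) (sum-zero {L} λ r → zeroʳ _) ⟩
      D i * 1# + 0#   ≈⟨ solve 1 (λ d → d :* con 1 :+ con 0 := con 1 :* d) refl (D i) ⟩
      1# * D i        ∎
    ∑-chainSum {z} D step (suc m) (suc L) i D≈0 = begin
      D (i ℕ.+ 0) * (X i * t 0)
        + sum {L} (λ r → D (i ℕ.+ suc (toℕ r))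
            * (X i * t (suc (toℕ r)) + chainSum (suc m) (toℕ r) (suc i)))
        -- The recursion of `chainSum` separates the tuples with smallest index i, from which `X i`
        -- is pulled out, from those starting at i + 1 or later.
        ≈⟨ +-cong (swap _ _ _) (trans
             (sum-cong-≋ {L} λ r → trans (distribˡ _ _ _)
               (+-cong (swap _ _ _) (*-congʳ (reflexive (≡.cong D (ℕ.+-suc i (toℕ r)))))))
             (∑-distrib-+ {L} _ _)) ⟩
      X i * (D (i ℕ.+ 0) * t 0)
        + (sum {L} (λ r → X i * (D (i ℕ.+ suc (toℕ r)) * t (suc (toℕ r))))
           + sum {L} (λ r → D (suc i ℕ.+ toℕ r) * chainSum (suc m) (toℕ r) (suc i)))
        ≈⟨ +-assoc _ _ _ ⟨
      sum {suc L} (λ r → X i * (D (i ℕ.+ toℕ r) * t (toℕ r)))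
        + sum {L} (λ r → D (suc i ℕ.+ toℕ r) * chainSum (suc m) (toℕ r) (suc i))
        -- Two induction hypotheses follow: bound i + 1 with L one smaller, then bound i with m one
        -- smaller. Both sums stop at the same zero of `D`.
        ≈⟨ +-cong (sym (*-distribˡ-sum {suc L} (X i) λ r → D (i ℕ.+ toℕ r) * t (toℕ r)))
             (∑-chainSum D step (suc m) L (suc i)
               (trans (reflexive (≡.cong D (≡.sym (ℕ.+-suc i L)))) D≈0)) ⟩
      X i * sum {suc L} (λ r → D (i ℕ.+ toℕ r) * t (toℕ r)) + z ^ suc m * D (suc i)
        ≈⟨ +-congʳ (*-congˡ (∑-chainSum D step m (suc L) i D≈0)) ⟩
      X i * (z ^ m * D i) + z * z ^ m * D (suc i)
        ≈⟨ solve 5 (λ x z zᵐ d d′ → x :* (zᵐ :* d) :+ z :* zᵐ :* d′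
             := zᵐ :* (d :* x :+ z :* d′)) refl (X i) z (z ^ m) (D i) (D (suc i)) ⟩
      z ^ m * (D i * X i + z * D (suc i))
        ≈⟨ *-congˡ (step i) ⟩
      z ^ m * (z * D i)
        ≈⟨ solve 3 (λ z zᵐ d → zᵐ :* (z :* d) := z :* zᵐ :* d) refl z (z ^ m) (D i) ⟩
      z ^ suc m * D i ∎
      where
      t = λ r → chainSum m r i

      swap : ∀ x y w → x * (y * w) ≈ y * (x * w)
      swap = solve 3 (λ x y w → x :* (y :* w) := y :* (x :* w)) refl

  -- Gaussian polynomials

  module Gaussian (q : Carrier) where

    -- Pascal's rule serves as the definition: it avoids division and extends [n, k] by 0 to k > n,
    -- the value needed at the ends of the sums.
    gaussian : ℕ → ℕ → Carrier
    gaussian n       zero    = 1#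
    gaussian zero    (suc k) = 0#
    gaussian (suc n) (suc k) = gaussian n k + q ^ suc k * gaussian n (suc k)

    gaussian-vanishes : ∀ {n k} → n ℕ.< k → gaussian n k ≈ 0#
    gaussian-vanishes {zero}  (s≤s _)   = refl
    gaussian-vanishes {suc n} {suc k} (s≤s n<k) = begin
      gaussian n k + q ^ suc k * gaussian n (suc k)
        ≈⟨ +-cong (gaussian-vanishes n<k) (*-congˡ (gaussian-vanishes (ℕ.m≤n⇒m≤1+n n<k))) ⟩
      0# + q ^ suc k * 0#
        ≈⟨ solve 1 (λ x → con 0 :+ x :* con 0 := con 0) refl (q ^ suc k) ⟩
      0# ∎

    -- The solver works over semirings and treats 1 - qⁿ as an unknown; this relation ties it to qⁿ
    -- in the Gaussian identities below.
    1-q^+q^≈1 : ∀ n → (1# - q ^ n) + q ^ n ≈ 1#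
    1-q^+q^≈1 n = trans (+-assoc _ _ _) (trans (+-congˡ (-‿inverseˡ _)) (+-identityʳ _))

    -- (qᵏ − qⁿ)[n, k] = qᵏ(1 − qᵏ⁺¹)[n, k + 1], with both sides moved so that
    -- it becomes a semiring identity modulo (1 − qᵏ) + qᵏ = 1.

    gaussian-ratio : ∀ n k →
      q ^ k * gaussian n k
      ≈ q ^ n * gaussian n k + q ^ k * (1# - q ^ suc k) * gaussian n (suc k)
    gaussian-ratio zero    zero    =
      solve 1 (λ u → con 1 :* con 1 := con 1 :* con 1 :+ con 1 :* u :* con 0) refl (1# - q ^ 1)
    gaussian-ratio zero    (suc k) =
      solve 2 (λ x u → x :* con 0 := con 1 :* con 0 :+ x :* u :* con 0) refl (q ^ suc k) _
    gaussian-ratio (suc n) zero    = begin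
      1# * 1#          ≈⟨ *-identityˡ 1# ⟩
      1#               ≈⟨ 1-q^+q^≈1 1 ⟨
      u + q * 1#       ≈⟨ +-congˡ (*-congˡ (trans (sym (*-identityˡ 1#)) (gaussian-ratio n zero))) ⟩
      u + q * (y * 1# + 1# * u * B)
        ≈⟨ solve 4 (λ q y u B → u :+ q :* (y :* con 1 :+ con 1 :* u :* B)
             := q :* y :* con 1 :+ con 1 :* u :* (con 1 :+ q :* con 1 :* B)) refl q y u B ⟩
      q * y * 1# + 1# * u * (1# + q * 1# * B) ∎
      where
      y = q ^ n
      u = 1# - q ^ 1
      B = gaussian n 1
    gaussian-ratio (suc n) (suc k) = begin
      q * x * (A + q * x * B)
        ≈⟨ solve 4 (λ q x A B → q :* x :* (A :+ q :* x :* B)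
             := q :* (x :* A) :+ q :* x :* B :* (q :* x)) refl q x A B ⟩
      q * (x * A) + q * x * B * (q * x)
        ≈⟨ +-congʳ (*-congˡ (gaussian-ratio n k)) ⟩
      q * (y * A + x * u * B) + q * x * B * (q * x)
        ≈⟨ solve 6 (λ q x y u A B → q :* (y :* A :+ x :* u :* B) :+ q :* x :* B :* (q :* x)
             := q :* y :* A :+ q :* x :* B :* (u :+ q :* x)) refl q x y u A B ⟩
      q * y * A + q * x * B * (u + q * x)
        -- Both brackets are 1; the exchange brings in `v`, the factor that also occurs in the
        -- induction hypothesis for k + 1.
        ≈⟨ +-congˡ (*-congˡ (trans (1-q^+q^≈1 (suc k)) (sym (1-q^+q^≈1 (suc (suc k)))))) ⟩
      q * y * A + q * x * B * (v + q * (q * x))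
        ≈⟨ solve 6 (λ q x y v A B → q :* y :* A :+ q :* x :* B :* (v :+ q :* (q :* x))
             := q :* y :* A :+ q :* x :* v :* B :+ q :* (q :* x) :* (q :* x :* B)) refl q x y v A B ⟩
      q * y * A + q * x * v * B + q * (q * x) * (q * x * B)
        ≈⟨ +-congˡ (*-congˡ (gaussian-ratio n (suc k))) ⟩
      q * y * A + q * x * v * B + q * (q * x) * (y * B + q * x * v * C)
        ≈⟨ solve 7 (λ q x y v A B C →
             q :* y :* A :+ q :* x :* v :* B :+ q :* (q :* x) :* (y :* B :+ q :* x :* v :* C)
             := q :* y :* (A :+ q :* x :* B) :+ q :* x :* v :* (B :+ q :* (q :* x) :* C))
             refl q x y v A B C ⟩
      q * y * (A + q * x * B) + q * x * v * (B + q * (q * x) * C) ∎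
      where
      x = q ^ k
      y = q ^ n
      u = 1# - q ^ suc k
      v = 1# - q ^ suc (suc k)
      A = gaussian n k
      B = gaussian n (suc k)
      C = gaussian n (suc (suc k))

    -- With q^(n+1) [n, k] added to both sides, Pascal's rule and `gaussian-ratio` reduce each side
    -- to [n, k].
    gaussian-absorption : ∀ n k →
      gaussian (suc n) (suc k) * (1# - q ^ suc k) ≈ (1# - q ^ suc n) * gaussian n k
    gaussian-absorption n k = +-cancelʳ (q * y * A) _ _ (begin
      (A + q * x * B) * u + q * y * A
        ≈⟨ solve 6 (λ q x y u A B → (A :+ q :* x :* B) :* u :+ q :* y :* A
             := A :* u :+ q :* (y :* A :+ x :* u :* B)) refl q x y u A B ⟩
      A * u + q * (y * A + x * u * B)
        ≈⟨ +-congˡ (*-congˡ (gaussian-ratio n k)) ⟨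
      A * u + q * (x * A)
        ≈⟨ solve 4 (λ q x u A → A :* u :+ q :* (x :* A) := (u :+ q :* x) :* A) refl q x u A ⟩
      (u + q * x) * A
        ≈⟨ *-congʳ (trans (1-q^+q^≈1 (suc k)) (sym (1-q^+q^≈1 (suc n)))) ⟩
      (w + q * y) * A
        ≈⟨ distribʳ A w (q * y) ⟩
      w * A + q * y * A ∎)
      where
      x = q ^ k
      y = q ^ n
      u = 1# - q ^ suc k
      w = 1# - q ^ suc n
      A = gaussian n k
      B = gaussian n (suc k)

    -- A form of `gaussian-ratio` prepared for division by (1 - q^(k+1))(1 - q^(n+1)), which leaves
    -- q^(k+1)/(1 - q^(k+1)) in front of [n, k].
    gaussian-ratio′ : ∀ n k →
      q ^ suc k * (1# - q ^ suc n) * gaussian n k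
      ≈ (1# - q ^ suc k) * (q ^ suc n * gaussian n k + q ^ suc k * gaussian n (suc k))
    gaussian-ratio′ n k = +-cancelʳ (q * x * (q * y) * A) _ _ (begin
      q * x * w * A + q * x * (q * y) * A
        ≈⟨ solve 5 (λ q x y w A → q :* x :* w :* A :+ q :* x :* (q :* y) :* A
             := q :* x :* A :* (w :+ q :* y)) refl q x y w A ⟩
      q * x * A * (w + q * y)
        ≈⟨ *-congˡ (1-q^+q^≈1 (suc n)) ⟩
      q * x * A * 1#
        ≈⟨ solve 3 (λ q x A → q :* x :* A :* con 1 := q :* (x :* A)) refl q x A ⟩
      q * (x * A)
        ≈⟨ *-congˡ (gaussian-ratio n k) ⟩
      q * (y * A + x * u * B)
        ≈⟨ solve 6 (λ q x y u A B → q :* (y :* A :+ x :* u :* B)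
             := q :* y :* A :* con 1 :+ u :* (q :* x :* B)) refl q x y u A B ⟩
      q * y * A * 1# + u * (q * x * B)
        ≈⟨ +-congʳ (*-congˡ (1-q^+q^≈1 (suc k))) ⟨
      q * y * A * (u + q * x) + u * (q * x * B)
        ≈⟨ solve 6 (λ q x y u A B → q :* y :* A :* (u :+ q :* x) :+ u :* (q :* x :* B)
             := u :* (q :* y :* A :+ q :* x :* B) :+ q :* x :* (q :* y) :* A) refl q x y u A B ⟩
      u * (q * y * A + q * x * B) + q * x * (q * y) * A ∎)
      where
      x = q ^ k
      y = q ^ n
      u = 1# - q ^ suc k
      w = 1# - q ^ suc n
      A = gaussian n k
      B = gaussian n (suc k)

    -- Comparison with quotients of Pochhammer products.

    pochhammer-suc : ∀ n → pochhammer q q (suc n) ≈ pochhammer q q n * (1# - q ^ suc n)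
    -- `product` is `sum` in the multiplicative monoid, and `q * q ^ n` is `q ^ suc n` by
    -- definition.
    pochhammer-suc n = trans (MonoidSum.sum-init-last *-monoid {n} (factor ∘ toℕ))
      (*-cong (MonoidSum.sum-cong-≋ *-monoid {n} λ i → reflexive (≡.cong factor (Fin.toℕ-inject₁ i)))
              (reflexive (≡.cong factor (Fin.toℕ-fromℕ n))))
      where
      factor : ℕ → Carrier
      factor i = 1# - q * q ^ i

    -- Writing n = k + l keeps truncated subtraction out of the induction on k, whose step is
    -- `gaussian-absorption`.
    gaussian-pochhammer : ∀ k l →
      gaussian (k ℕ.+ l) k * (pochhammer q q k * pochhammer q q l) ≈ pochhammer q q (k ℕ.+ l)
    gaussian-pochhammer zero    l = trans (*-identityˡ _) (*-identityˡ _)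
    gaussian-pochhammer (suc k) l = begin
      G′ * (pochhammer q q (suc k) * Pl)
        ≈⟨ *-congˡ (*-congʳ (pochhammer-suc k)) ⟩
      G′ * (Pk * u * Pl)
        ≈⟨ solve 4 (λ G Pk u Pl → G :* (Pk :* u :* Pl) := G :* u :* (Pk :* Pl)) refl G′ Pk u Pl ⟩
      G′ * u * (Pk * Pl)
        ≈⟨ *-congʳ (gaussian-absorption (k ℕ.+ l) k) ⟩
      w * G * (Pk * Pl)
        ≈⟨ solve 3 (λ w G P → w :* G :* P := G :* P :* w) refl w G (Pk * Pl) ⟩
      G * (Pk * Pl) * w
        ≈⟨ *-congʳ (gaussian-pochhammer k l) ⟩
      pochhammer q q (k ℕ.+ l) * w
        ≈⟨ pochhammer-suc (k ℕ.+ l) ⟨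
      pochhammer q q (suc k ℕ.+ l) ∎
      where
      G  = gaussian (k ℕ.+ l) k
      G′ = gaussian (suc k ℕ.+ l) (suc k)
      Pk = pochhammer q q k
      Pl = pochhammer q q l
      u  = 1# - q ^ suc k
      w  = 1# - q ^ suc (k ℕ.+ l)

    qBinomial≈gaussian : ∀ (q^n#1 : NotRootOfUnity q) {n k} → k ℕ.≤ n →
                         qBinomial q^n#1 n k ≈ gaussian n k
    qBinomial≈gaussian q^n#1 {n} {k} k≤n = /-unique _
      (≡.subst (λ n′ → gaussian n′ k * (pochhammer q q k * pochhammer q q (n ∸ k)) ≈ pochhammer q q n′)
        (ℕ.m+[n∸m]≡n k≤n) (gaussian-pochhammer k (n ∸ k)))

  -- In increment and coefficient the index j stands for k = j + 1 of the sum.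

  module Duality {q : Carrier} (q#0 : q # 0#) (q^n#1 : NotRootOfUnity q) where

    open Gaussian q

    -- Powers of q and of its inverse.

    p : Carrier
    p = inv q q#0

    p^q^≈1 : ∀ n → p ^ n * q ^ n ≈ 1#
    p^q^≈1 n = trans (sym (^-distrib-* p q n)) (trans (^-congˡ n (inv-inverseˡ q q#0)) (1^n≈1 n))

    r : ℕ → Carrier
    r j = inv (1# - q ^ suc j) (1-q^#0 q^n#1 (suc j))

    r-inverseˡ : ∀ j → r j * (1# - q ^ suc j) ≈ 1#
    r-inverseˡ j = inv-inverseˡ (1# - q ^ suc j) (1-q^#0 q^n#1 (suc j))

    -- The x of the overview at k = j + 1; it agrees by computation with the factors of the inner
    -- product in the theorem.
    X : ℕ → Carrier
    X j = q ^ suc j * r j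

    open Chains X

    -- This is q^(-kn + C(k,2)) for k = j + 1, with the negative part of the exponent carried by
    -- `p`.
    power : ℕ → ℕ → Carrier
    power n j = p ^ (suc j ℕ.* n) * q ^ (suc j C 2)

    power-sucˡ : ∀ n j → power (suc n) j * q ^ suc j ≈ power n j
    power-sucˡ n j = begin
      p ^ (suc j ℕ.* suc n) * b * q ^ suc j
        ≈⟨ *-congʳ (*-congʳ (trans (reflexive (≡.cong (p ^_) (ℕ.*-suc (suc j) n)))
             (^-homo-* p (suc j) (suc j ℕ.* n)))) ⟩
      p ^ suc j * a * b * q ^ suc j
        ≈⟨ solve 4 (λ s a b t → s :* a :* b :* t := a :* b :* (s :* t)) refl (p ^ suc j) a b (q ^ suc j) ⟩
      a * b * (p ^ suc j * q ^ suc j)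
        ≈⟨ *-congˡ (p^q^≈1 (suc j)) ⟩
      a * b * 1#
        ≈⟨ *-identityʳ _ ⟩
      a * b ∎
      where
      a = p ^ (suc j ℕ.* n)
      b = q ^ (suc j C 2)

    -- Since C(k + 1, 2) = k + C(k, 2), passing from k to k + 1 multiplies the power by q^(k - n).
    power-sucʳ : ∀ n j → q ^ n * power n (suc j) ≈ q ^ suc j * power n j
    power-sucʳ n j = begin
      q ^ n * (p ^ (n ℕ.+ suc j ℕ.* n) * q ^ (suc (suc j) C 2))
        ≈⟨ *-congˡ (*-cong (^-homo-* p n (suc j ℕ.* n)) (trans (reflexive (≡.cong (q ^_) C-suc))
             (^-homo-* q (suc j) (suc j C 2)))) ⟩
      q ^ n * (p ^ n * a * (q ^ suc j * b))
        ≈⟨ solve 5 (λ t s a x b → t :* (s :* a :* (x :* b)) := s :* t :* (x :* (a :* b)))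
             refl (q ^ n) (p ^ n) a (q ^ suc j) b ⟩
      p ^ n * q ^ n * (q ^ suc j * (a * b))
        ≈⟨ *-congʳ (p^q^≈1 n) ⟩
      1# * (q ^ suc j * (a * b))
        ≈⟨ *-identityˡ _ ⟩
      q ^ suc j * (a * b) ∎
      where
      a = p ^ (suc j ℕ.* n)
      b = q ^ (suc j C 2)

      C-suc : suc (suc j) C 2 ≡ suc j ℕ.+ suc j C 2
      C-suc = ≡.trans (≡.sym (nCk+nC[k+1]≡[n+1]C[k+1] (suc j) 1))
                      (≡.cong (ℕ._+ suc j C 2) (nC1≡n (suc j)))

    -- The coefficients and their increments in n.

    coefficient : ℕ → ℕ → Carrier
    coefficient n j = gaussian n (suc j) * (- 1#) ^ j * power n j

    -- This is d(n + 1, j + 1) of the overview: the first argument is shifted too.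
    increment : ℕ → ℕ → Carrier
    increment n j = gaussian n j * (- 1#) ^ j * power (suc n) j

    -- Pascal's rule; the factor q^(j+1) of its second term turns `power (suc n) j` into
    -- `power n j`.
    coefficient-suc : ∀ n j → coefficient (suc n) j ≈ coefficient n j + increment n j
    coefficient-suc n j = begin
      (A + x * B) * s * e′
        ≈⟨ solve 5 (λ A B x s e → (A :+ x :* B) :* s :* e := B :* s :* (e :* x) :+ A :* s :* e)
             refl A B x s e′ ⟩
      B * s * (e′ * x) + A * s * e′
        ≈⟨ +-congʳ (*-congˡ (power-sucˡ n j)) ⟩
      B * s * power n j + A * s * e′ ∎
      where
      A = gaussian n j
      B = gaussian n (suc j)
      x = q ^ suc j
      s = (- 1#) ^ j
      e′ = power (suc n) j

    coefficient-vanishes : ∀ n → coefficient n n ≈ 0#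
    coefficient-vanishes n = trans
      (*-congʳ (trans (*-congʳ (gaussian-vanishes (ℕ.n<1+n n))) (zeroˡ _))) (zeroˡ _)

    increment-vanishes : ∀ n → increment n (suc n) ≈ 0#
    increment-vanishes n = trans
      (*-congʳ (trans (*-congʳ (gaussian-vanishes (ℕ.n<1+n n))) (zeroˡ _))) (zeroˡ _)

    increment-zero : ∀ n → increment n 0 ≈ p ^ suc n
    increment-zero n = trans
      (solve 1 (λ x → con 1 :* con 1 :* (x :* con 1) := x) refl (p ^ (1 ℕ.* suc n)))
      (reflexive (≡.cong (p ^_) (ℕ.*-identityˡ (suc n))))

    -- The hypothesis of `∑-chainSum` for z = `X n`. After `ratio` and `power-sucʳ` both terms carry
    -- the same power of q, and the two occurrences of [n, j + 1] cancel by their signs.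
    increment-step : ∀ n j →
      increment n j * X j + X n * increment n (suc j) ≈ X n * increment n j
    increment-step n j = begin
      A * s * e * (x * r j) + y * r n * (B * (- 1# * s) * e′)
        ≈⟨ solve 10 (λ A B s e e′ x y rj rn σ →
             A :* s :* e :* (x :* rj) :+ y :* rn :* (B :* (σ :* s) :* e′)
             := s :* e :* (x :* rj :* A) :+ rn :* B :* (σ :* s) :* (y :* e′))
             refl A B s e e′ x y (r j) (r n) (- 1#) ⟩
      s * e * (x * r j * A) + r n * B * (- 1# * s) * (y * e′)
        ≈⟨ +-cong (*-congˡ ratio) (*-congˡ (power-sucʳ (suc n) j)) ⟩
      s * e * (r n * (y * A + x * B)) + r n * B * (- 1# * s) * (x * e)
        -- The solver sees -1 as an unknown, so the cancelling factor 1 + (-1) is isolated here and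
        -- removed afterwards.
        ≈⟨ solve 8 (λ A B s e x y rn σ →
             s :* e :* (rn :* (y :* A :+ x :* B)) :+ rn :* B :* (σ :* s) :* (x :* e)
             := y :* rn :* (A :* s :* e) :+ (con 1 :+ σ) :* (s :* e :* rn :* x :* B))
             refl A B s e x y (r n) (- 1#) ⟩
      y * r n * (A * s * e) + (1# - 1#) * (s * e * r n * x * B)
        ≈⟨ +-congˡ (trans (*-congʳ (-‿inverseʳ 1#)) (zeroˡ _)) ⟩
      y * r n * (A * s * e) + 0#
        ≈⟨ +-identityʳ _ ⟩
      y * r n * (A * s * e) ∎
      where
      A = gaussian n j
      B = gaussian n (suc j)
      s = (- 1#) ^ j
      e = power (suc n) j
      e′ = power (suc n) (suc j)
      x = q ^ suc j
      y = q ^ suc n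
      u = 1# - q ^ suc j
      w = 1# - q ^ suc n

      ratio : x * r j * A ≈ r n * (y * A + x * B)
      ratio = begin
        x * r j * A              ≈⟨ *-identityˡ _ ⟨
        1# * (x * r j * A)       ≈⟨ *-congʳ (r-inverseˡ n) ⟨
        r n * w * (x * r j * A)
          ≈⟨ solve 5 (λ rn w x rj A → rn :* w :* (x :* rj :* A) := rn :* rj :* (x :* w :* A))
               refl (r n) w x (r j) A ⟩
        r n * r j * (x * w * A)  ≈⟨ *-congˡ (gaussian-ratio′ n j) ⟩
        r n * r j * (u * (y * A + x * B))
          ≈⟨ solve 4 (λ rn rj u z → rn :* rj :* (u :* z) := rj :* u :* (rn :* z))
               refl (r n) (r j) u (y * A + x * B) ⟩
        r j * u * (r n * (y * A + x * B))  ≈⟨ *-congʳ (r-inverseˡ j) ⟩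
        1# * (r n * (y * A + x * B))       ≈⟨ *-identityˡ _ ⟩
        r n * (y * A + x * B)    ∎

    -- Induction on n and the summands of the right-hand side.

    dualSum : ℕ → ℕ → Carrier
    dualSum m n = sum {n} λ j → coefficient n (toℕ j) * chainSum m (toℕ j) 0

    -- The old coefficients extend to the new index j = n by 0, because [n, n + 1] = 0. The
    -- increments are summed by `∑-chainSum` from bound 0, and their first value is q^(-n-1).
    dualSum-suc : ∀ m n → dualSum m (suc n) ≈ dualSum m n + X n ^ m * p ^ suc n
    dualSum-suc m n = begin
      sum {suc n} (λ j → coefficient (suc n) (toℕ j) * t (toℕ j))
        ≈⟨ sum-cong-≋ {suc n} (λ j → trans (*-congʳ (coefficient-suc n (toℕ j))) (distribʳ (t (toℕ j)) _ _)) ⟩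
      sum {suc n} (λ j → coefficient n (toℕ j) * t (toℕ j) + increment n (toℕ j) * t (toℕ j))
        ≈⟨ ∑-distrib-+ {suc n} (λ j → coefficient n (toℕ j) * t (toℕ j))
             (λ j → increment n (toℕ j) * t (toℕ j)) ⟩
      sum {suc n} (λ j → coefficient n (toℕ j) * t (toℕ j))
        + sum {suc n} (λ j → increment n (toℕ j) * t (toℕ j))
        ≈⟨ +-cong (sum-last n (λ j → coefficient n j * t j))
             (∑-chainSum (increment n) (increment-step n) m (suc n) 0 (increment-vanishes n)) ⟩
      dualSum m n + coefficient n n * t n + X n ^ m * increment n 0
        ≈⟨ +-cong (trans (+-congˡ (trans (*-congʳ (coefficient-vanishes n)) (zeroˡ _))) (+-identityʳ _))
             (*-congˡ (increment-zero n)) ⟩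
      dualSum m n + X n ^ m * p ^ suc n ∎
      where t = λ j → chainSum m j 0

    dualSum≈ : ∀ m n → dualSum m n ≈ sum {n} (λ j → X (toℕ j) ^ m * p ^ index j)
    dualSum≈ m zero    = refl
    dualSum≈ m (suc n) = begin
      dualSum m (suc n)                   ≈⟨ dualSum-suc m n ⟩
      dualSum m n + X n ^ m * p ^ suc n   ≈⟨ +-congʳ (dualSum≈ m n) ⟩
      sum {n} (λ j → X (toℕ j) ^ m * p ^ index j) + X n ^ m * p ^ suc n
        ≈⟨ sum-last n (λ j → X j ^ m * p ^ suc j) ⟨
      sum {suc n} (λ j → X (toℕ j) ^ m * p ^ index j) ∎

    -- As X j (1 - q^k) = q^k for k = j + 1, clearing the denominator leaves q^(k(m+1)), and the
    -- inverse power of q^k lowers this to q^(km).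
    q^/[1-q^]^ : ∀ m j →
      q ^ (suc j ℕ.* m) / ((1# - q ^ suc j) ^ suc m) [ ^#0 (1-q^#0 q^n#1 (suc j)) (suc m) ]
      ≈ X j ^ suc m * p ^ suc j
    q^/[1-q^]^ m j = /-unique _ (begin
      X j ^ suc m * p ^ suc j * u ^ suc m
        ≈⟨ solve 3 (λ a b c → a :* b :* c := b :* (a :* c)) refl (X j ^ suc m) (p ^ suc j) (u ^ suc m) ⟩
      p ^ suc j * (X j ^ suc m * u ^ suc m)
        ≈⟨ *-congˡ (^-distrib-* (X j) u (suc m)) ⟨
      p ^ suc j * (X j * u) ^ suc m
        ≈⟨ *-congˡ (^-congˡ (suc m) (trans (*-assoc _ _ _)
             (trans (*-congˡ (r-inverseˡ j)) (*-identityʳ _)))) ⟩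
      p ^ suc j * (q ^ suc j * (q ^ suc j) ^ m)
        ≈⟨ *-assoc _ _ _ ⟨
      p ^ suc j * q ^ suc j * (q ^ suc j) ^ m
        ≈⟨ *-cong (p^q^≈1 (suc j)) (^-assocʳ q (suc j) m) ⟩
      1# * q ^ (suc j ℕ.* m)
        ≈⟨ *-identityˡ _ ⟩
      q ^ (suc j ℕ.* m) ∎)
      where u = 1# - q ^ suc j

theorem1 : ∀ {c ℓ₁ ℓ₂} (K : HeytingField c ℓ₁ ℓ₂) →
  let open HeytingField K
      open FieldNotions K
  in
  CharacteristicZero →
  (q : Carrier) (q#0 : q # 0#) (q^n#1 : NotRootOfUnity q) →
  (n m : ℕ) .{{_ : NonZero n}} .{{_ : NonZero m}} →
  (∑[1≤ k ≤ n ]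
     (qBinomial q^n#1 n k
       * (- 1#) ^ (k ∸ 1)
       * zpow q q#0 (ℤ.- (+ (k ℕ.* n)) ℤ.+ + (k C 2))
       * (∑[ i ∈ chains m k ] (∏[ iⱼ ∈ i ]
           (q ^ index iⱼ / (1# - q ^ index iⱼ) [ 1-q^#0 q^n#1 (index iⱼ) ])))))
  ≈
  (∑[1≤ k ≤ n ]
     (q ^ (k ℕ.* (m ∸ 1)) / ((1# - q ^ k) ^ m) [ ^#0 (1-q^#0 q^n#1 k) m ]))
theorem1 K _ q q#0 q^n#1 n (suc m) = trans
  -- For k = `index j` the exponent `k ∸ 1` computes to `toℕ j`, so matching the remaining factors
  -- gives the summand of `dualSum (suc m) n`.
  (sum-cong-≋ {n} λ j → *-cong
    (*-cong (*-congʳ (qBinomial≈gaussian q^n#1 (Fin.toℕ<n j)))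
            (zpow-neg-+ q q#0 (index j ℕ.* n) (index j C 2)))
    (∑-chains m (toℕ j)))
  (trans (dualSum≈ (suc m) n)
         (sum-cong-≋ {n} λ j → sym (q^/[1-q^]^ m (toℕ j))))
  where
  open HeytingField K
  open FieldNotions K
  open FieldProperties K
  open Gaussian q
  open Duality q#0 q^n#1
  open Chains X
  open SemiringSum (CommutativeRing.semiring
    (HeytingCommutativeRing.commutativeRing heytingCommutativeRing)) using (sum-cong-≋)
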